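{- Let $\phi$ be a formula in the language of $\mathbf{PD}$ whose propositional variables are among $p_{i_1},\dots,p_{i_n}$ (with $n\ge1$ and $i_1,\dots,i_n$ distinct), and let $N=\{i_1,\dots,i_n\}$. Then $\phi$ is semantically equivalent to a formula in conjunctive normal form $$\bigwedge_{g\in G}\bigl(\alpha_{k_g}\otimes\Theta_{2^N\setminus Y_g}\bigr),$$ where $G$ is a finite set of indices and each $Y_g$ is a nonempty team on $N$ with $|Y_g|=k_g+1$.
   Context: Propositional variables are $p_i$, $i\in\mathbb{N}$. A valuation is a function $s:\mathbb{N}\to\{0,1\}$; a team is a set of valuations. For finite $N\subseteq\mathbb{N}$, $2^N$ is the set of all functions $N\to\{0,1\}$ and a team on $N$ is a subset of $2^N$. Formulas of $\mathbf{PD}$ (propositional dependence logic) are given by $$\phi::=p_i\mid\neg p_i\mid\bot\mid\mathop{=}(p_{i_1},\dots,p_{i_k},p_j)\mid(\phi\wedge\phi)\mid(\phi\otimes\phi),$$ where $k\ge 0$ (for $k=0$ the dependence atom is $\mathop{=}(p_j)$). Truth on a team $X$: - $X\models p_i$ iff $s(i)=1$ for all $s\in X$; $X\models\neg p_i$ iff $s(i)=0$ for all $s\in X$; $X\models\bot$ iff $X=\emptyset$; - $X\models\mathop{=}(p_{i_1},\dots,p_{i_k},p_j)$ iff for all $s,s'\in X$, if $s(i_1)=s'(i_1),\dots,s(i_k)=s'(i_k)$ then $s(j)=s'(j)$; - $X\models\phi\wedge\psi$ iff $X\models\phi$ and $X\models\psi$; - $X\models\phi\otimes\psi$ iff there are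 $Y,Z\subseteq X$ with $X=Y\cup Z$, $Y\models\phi$ and $Z\models\psi$. Formulas are semantically equivalent if they are true on the same teams. Write $p_i^1:=p_i$, $p_i^0:=\neg p_i$. For a team $X$ on $N=\{i_1,\dots,i_n\}$, $$\Theta_X:=\bigotimes_{s\in X}(p_{i_1}^{s(i_1)}\wedge\dots\wedge p_{i_n}^{s(i_n)}),\qquad \Theta_\emptyset:=\bot.$$ Also $\alpha_0:=\bot$, $\alpha_1:=\mathop{=}(p_{i_1})\wedge\dots\wedge\mathop{=}(p_{i_n})$, and for $m\ge2$, $\alpha_m:=\bigotimes_{i=1}^m\alpha_1$ (the $\otimes$ of $m$ copies of $\alpha_1$). The empty conjunction ($G=\emptyset$) is understood as true on every team. -}

module Defs where

open import Data.Bool using (Bool; true; false; not)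
open import Data.List using (List; []; _∷_; [_]; _++_; map; replicate; filterᵇ; length; cartesianProductWith)
open import Data.List.Relation.Unary.All as All using (All)
open import Data.Nat using (ℕ; zero; suc)
open import Data.Product using (∃-syntax; _×_)
open import Data.Vec as Vec using (Vec; []; _∷_)
open import Function using (_∘_)
open import Function.Bundles using (_⇔_)
open import Level using (0ℓ; Lift; lift) renaming (suc to lsuc)
open import Relation.Binary.PropositionalEquality using (_≡_)
open import Relation.Unary using (Pred; _∈_; _⊆_; _∪_; _≐_; Empty)

infix  4 _⊨_ _≡ₛ_
infixr 6 _∧_
infixr 5 _⊗_

Valuation : Set
Valuation = ℕ → Bool

Team : Set₁
Team = Pred Valuation 0ℓ

data Formula : Set where
  var  : ℕ → Formula
  ¬var : ℕ → Formula
  bot  : Formula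
  dep  : List ℕ → ℕ → Formula
  _∧_  : Formula → Formula → Formula
  _⊗_  : Formula → Formula → Formula

vars : Formula → List ℕ
vars (var i)    = [ i ]
vars (¬var i)   = [ i ]
vars bot        = []
vars (dep is j) = is ++ [ j ]
vars (φ ∧ ψ)    = vars φ ++ vars ψ
vars (φ ⊗ ψ)    = vars φ ++ vars ψ

-- Satisfaction lives in Set₁ because ⊗ quantifies over teams.
_⊨_ : Team → Formula → Set₁
X ⊨ var i    = Lift (lsuc 0ℓ) (∀ s → s ∈ X → s i ≡ true)
X ⊨ ¬var i   = Lift (lsuc 0ℓ) (∀ s → s ∈ X → s i ≡ false)
X ⊨ bot      = Lift (lsuc 0ℓ) (Empty X)
X ⊨ dep is j = Lift (lsuc 0ℓ)
  (∀ s s′ → s ∈ X → s′ ∈ X → All (λ i → s i ≡ s′ i) is → s j ≡ s′ j)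
X ⊨ φ ∧ ψ    = X ⊨ φ × X ⊨ ψ
X ⊨ φ ⊗ ψ    = ∃[ Y ] ∃[ Z ] (Y ⊆ X × Z ⊆ X × X ≐ Y ∪ Z × Y ⊨ φ × Z ⊨ ψ)

_≡ₛ_ : Formula → Formula → Set₁
φ ≡ₛ ψ = ∀ (X : Team) → (X ⊨ φ) ⇔ (X ⊨ ψ)

⨂ : List Formula → Formula
⨂ []           = bot
⨂ (φ ∷ [])     = φ
⨂ (φ ∷ ψ ∷ φs) = φ ⊗ ⨂ (ψ ∷ φs)

⋀⁺ : ∀ {m} → Vec Formula (suc m) → Formula
⋀⁺ = Vec.foldr₁ _∧_

-- PD has no constant for truth; the empty conjunction is represented by the
-- dependence atom =(pᵢ , pᵢ), which is true on every team (⊨-top).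
top : ℕ → Formula
top i = dep [ i ] i

⊨-top : ∀ i X → X ⊨ top i
⊨-top i X = lift λ _ _ _ _ → All.head

-- The first argument only serves to name a variable for the empty conjunction.
⋀ : ℕ → List Formula → Formula
⋀ i []           = top i
⋀ i (φ ∷ [])     = φ
⋀ i (φ ∷ ψ ∷ φs) = φ ∧ ⋀ i (ψ ∷ φs)

-- For N = {i₁,…,iₙ} listed without repetition by is : Vec ℕ n, an element s
-- of 2ᴺ is given by the vector of its values s(i₁),…,s(iₙ).  As 2ᴺ is finite,
-- its subsets are given by their Boolean characteristic functions.
TeamOn : ℕ → Set
TeamOn n = Vec Bool n → Bool

valuationsOn : ∀ n → List (Vec Bool n)
valuationsOn zero    = [ [] ]
valuationsOn (suc n) = cartesianProductWith _∷_ (true ∷ false ∷ []) (valuationsOn n)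

elements : ∀ {n} → TeamOn n → List (Vec Bool n)
elements {n} Y = filterᵇ Y (valuationsOn n)

∣_∣ : ∀ {n} → TeamOn n → ℕ
∣ Y ∣ = length (elements Y)

Nonempty : ∀ {n} → TeamOn n → Set
Nonempty Y = ∃[ s ] Y s ≡ true

∁ : ∀ {n} → TeamOn n → TeamOn n
∁ Y = not ∘ Y

literal : ℕ → Bool → Formula
literal i true  = var i
literal i false = ¬var i

Θ : ∀ {m} → Vec ℕ (suc m) → TeamOn (suc m) → Formula
Θ is Y = ⨂ (map (λ s → ⋀⁺ (Vec.zipWith literal is s)) (elements Y))

α : ∀ {m} → Vec ℕ (suc m) → ℕ → Formula
α is k = ⨂ (replicate k (⋀⁺ (Vec.map (dep []) is)))

{-# OPTIONS --safe #-}
-- Satisfaction of φ by a team X depends only on the restriction X↾N and is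
-- downward closed.  Hence X ⊨ φ iff X↾N includes no team Y on N falsifying φ.
-- As X ⊨ α_k iff ∣X↾N∣ ≤ k, and X ⊨ Θ_Y iff X↾N ⊆ Y, the formula
-- α_k ⊗ Θ_{2ᴺ∖Y} with ∣Y∣ = k + 1 says precisely that Y ⊈ X↾N.
-- So the conjuncts are indexed by the teams Y on N that falsify φ.
module Submission where

open import Defs
open import Axiom.ExcludedMiddle using (ExcludedMiddle)
open import Data.Bool using (Bool; true; false; not)
open import Data.Bool.Properties using (T-≡)
open import Data.Fin using (Fin)
open import Data.List as List using (List; []; _∷_; _++_; length; tabulate)
open import Data.List.Membership.Propositional using () renaming (_∈_ to _∈ₗ_)
open import Data.List.Membership.Propositional.Properties
  using (∈-++⁺ˡ; ∈-++⁺ʳ; ∈-++⁻; ∈-∃++; ∈-filter⁺; ∈-filter⁻; ∈-lookup; ∈-cartesianProductWith⁺)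
open import Data.List.Properties using (length-++)
open import Data.List.Relation.Binary.Pointwise using (Pointwise; []; _∷_)
open import Data.List.Relation.Unary.All as All using (All; []; _∷_)
open import Data.List.Relation.Unary.All.Properties as All using (++⁻ˡ; ++⁻ʳ)
open import Data.List.Relation.Unary.AllPairs using ([]; _∷_)
open import Data.List.Relation.Unary.Any as Any using (here; there)
open import Data.List.Relation.Unary.Any.Properties using (lookup-index; singleton⁻)
open import Data.List.Relation.Unary.Unique.Propositional using () renaming (Unique to Uniqueₗ)
open import Data.List.Relation.Unary.Unique.Propositional.Properties using (cartesianProductWith⁺; filter⁺)
open import Data.Nat using (ℕ; zero; suc; pred; _+_; _≤_; z≤n; s≤s)
open import Data.Nat.Properties using (suc-injective; 1+n≰n; module ≤-Reasoning)
open import Data.Product using (∃; ∃-syntax; Σ-syntax; _×_; _,_; proj₁; proj₂)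
open import Data.Sum using (_⊎_; inj₁; inj₂)
open import Data.Vec as Vec using (Vec; []; _∷_; head)
open import Data.Vec.Membership.Propositional using (_∈_)
open import Data.Vec.Properties using (∷-injective; ∷-injectiveˡ; ∷-injectiveʳ)
open import Data.Vec.Relation.Unary.Any using (here; there)
open import Data.Vec.Relation.Unary.Unique.Propositional using (Unique)
open import Function using (_∘_)
open import Function.Bundles using (_⇔_; mk⇔; Equivalence)
open import Level using (0ℓ; lift; lower) renaming (suc to lsuc)
open import Relation.Binary.PropositionalEquality
  using (_≡_; _≢_; refl; sym; trans; cong; cong₂; subst)
open import Relation.Nullary using (¬_; Dec; yes; no; does; contradiction)
open import Relation.Nullary.Decidable using (map′; dec-true; decidable-stable)
open import Relation.Unary using (Empty; _∩_)

open Equivalence using (to; from)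

private
  variable
    A : Set
    n : ℕ

-- Lists without repetition

∈-remove : ∀ {x v : A} as {bs} → v ∈ₗ as ++ x ∷ bs → v ≢ x → v ∈ₗ as ++ bs
∈-remove as v∈ v≢x with ∈-++⁻ as v∈
... | inj₁ v∈as         = ∈-++⁺ˡ v∈as
... | inj₂ (here v≡x)   = contradiction v≡x v≢x
... | inj₂ (there v∈bs) = ∈-++⁺ʳ as v∈bs

length-insert : ∀ {x : A} as {bs} → length (as ++ x ∷ bs) ≡ suc (length (as ++ bs))
length-insert []       = refl
length-insert (_ ∷ as) = cong suc (length-insert as)

-- Pigeonhole by induction: one occurrence of the head `x` is deleted from `ys`, and the tail still
-- embeds because its entries differ from `x`.
Unique-⊆⇒length≤ : ∀ {xs ys : List A} → Uniqueₗ xs → (∀ {v} → v ∈ₗ xs → v ∈ₗ ys) →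
                   length xs ≤ length ys
Unique-⊆⇒length≤ [] _ = z≤n
Unique-⊆⇒length≤ {xs = x ∷ xs} {ys} (x∉xs ∷ xs!) xs⊆ys with ∈-∃++ (xs⊆ys (here refl))
... | as , bs , refl = begin
  suc (length xs)         ≤⟨ s≤s (Unique-⊆⇒length≤ xs! λ v∈xs →
                               ∈-remove as (xs⊆ys (there v∈xs)) (All.lookup x∉xs v∈xs ∘ sym)) ⟩
  suc (length (as ++ bs)) ≡⟨ length-insert as ⟨
  length ys               ∎
  where open ≤-Reasoning

-- Teams on finite sets of variables

booleans-complete : (b : Bool) → b ∈ₗ true ∷ false ∷ []
booleans-complete true  = here refl
booleans-complete false = there (here refl)

valuationsOn-complete : (v : Vec Bool n) → v ∈ₗ valuationsOn n
valuationsOn-complete         []      = here refl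
valuationsOn-complete {suc n} (b ∷ v) = ∈-cartesianProductWith⁺ _∷_
  {xs = true ∷ false ∷ []} {ys = valuationsOn n} (booleans-complete b) (valuationsOn-complete v)

valuationsOn-unique : ∀ n → Uniqueₗ (valuationsOn n)
valuationsOn-unique zero    = [] ∷ []
valuationsOn-unique (suc n) = cartesianProductWith⁺ _∷_ ∷-injective
  (((λ ()) ∷ []) ∷ [] ∷ []) (valuationsOn-unique n)

elements-unique : (Y : TeamOn n) → Uniqueₗ (elements Y)
elements-unique Y = filter⁺ _ (valuationsOn-unique _)

∈-elements⁺ : (Y : TeamOn n) → ∀ {v} → Y v ≡ true → v ∈ₗ elements Y
∈-elements⁺ Y {v} Yv = ∈-filter⁺ _ (valuationsOn-complete v) (from T-≡ Yv)

∈-elements⁻ : (Y : TeamOn n) → ∀ {v} → v ∈ₗ elements Y → Y v ≡ true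
∈-elements⁻ {n} Y v∈ = to T-≡ (proj₂ (∈-filter⁻ _ {xs = valuationsOn n} v∈))

∣∣-nonempty : (Y : TeamOn n) → Nonempty Y → ∣ Y ∣ ≡ suc (pred ∣ Y ∣)
∣∣-nonempty Y (_ , Yv) with elements Y | ∈-elements⁺ Y Yv
... | _ ∷ _ | _ = refl

-- A team on `suc n` variables amounts to two teams on `n` variables, one for each value of the
-- first variable.
glue : TeamOn n → TeamOn n → TeamOn (suc n)
glue Y Z (true ∷ v)  = Y v
glue Y Z (false ∷ v) = Z v

teamsOn : ∀ n → List (TeamOn n)
teamsOn zero    = (λ _ → true) ∷ (λ _ → false) ∷ []
teamsOn (suc n) = List.cartesianProductWith glue (teamsOn n) (teamsOn n)

-- Only pointwise agreement is claimed, since equality of characteristic functions would take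
-- function extensionality.
teamsOn-complete : (Y : TeamOn n) → ∃[ Z ] Z ∈ₗ teamsOn n × (∀ v → Z v ≡ Y v)
teamsOn-complete {zero} Y with Y [] in eq
... | true  = _ , here refl         , λ { [] → sym eq }
... | false = _ , there (here refl) , λ { [] → sym eq }
teamsOn-complete {suc n} Y
  with Z₁ , Z₁∈ , eq₁ ← teamsOn-complete (Y ∘ (true ∷_))
     | Z₀ , Z₀∈ , eq₀ ← teamsOn-complete (Y ∘ (false ∷_))
  = glue Z₁ Z₀ , ∈-cartesianProductWith⁺ glue Z₁∈ Z₀∈
  , λ { (true ∷ v) → eq₁ v ; (false ∷ v) → eq₀ v }

∈-or-∈∁ : (Y : TeamOn n) → ∀ v → Y v ≡ true ⊎ ∁ Y v ≡ true
∈-or-∈∁ Y v with Y v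
... | true  = inj₁ refl
... | false = inj₂ refl

infix 8 _↾_

_↾_ : Valuation → Vec ℕ n → Vec Bool n
s ↾ is = Vec.map s is

-- The largest team whose restrictions all lie in `Y`; formulas are evaluated on it in place of `Y`.
extend : Vec ℕ n → TeamOn n → Team
extend is Y s = Y (s ↾ is) ≡ true

infix 4 _⊆_↾_

_⊆_↾_ : TeamOn n → Team → Vec ℕ n → Set
Y ⊆ X ↾ is = ∀ v → Y v ≡ true → ∃[ s ] X s × s ↾ is ≡ v

↾-agree : ∀ {is : Vec ℕ n} {i s t} → i ∈ is → s ↾ is ≡ t ↾ is → s i ≡ t i
↾-agree {is = _ ∷ _} (here refl) eq = ∷-injectiveˡ eq
↾-agree {is = _ ∷ _} (there i∈)  eq = ↾-agree i∈ (∷-injectiveʳ eq)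

-- Semantics

⊗-intro : ∀ φ ψ {X P Q : Team} → (∀ s → X s → P s ⊎ Q s) →
          X ∩ P ⊨ φ → X ∩ Q ⊨ ψ → X ⊨ φ ⊗ ψ
⊗-intro φ ψ {X} {P} {Q} cover p q =
  X ∩ P , X ∩ Q , proj₁ , proj₁ , (X⊆ , λ { (inj₁ s∈) → proj₁ s∈ ; (inj₂ s∈) → proj₁ s∈ }) , p , q
  where
  X⊆ : ∀ {s} → X s → (X ∩ P) s ⊎ (X ∩ Q) s
  X⊆ {s} s∈ with cover s s∈
  ... | inj₁ Ps = inj₁ (s∈ , Ps)
  ... | inj₂ Qs = inj₂ (s∈ , Qs)

⊗-elim : ∀ φ ψ {X P Q : Team} →
         (∀ Y → Y ⊨ φ → ∀ s → Y s → P s) → (∀ Z → Z ⊨ ψ → ∀ s → Z s → Q s) →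
         X ⊨ φ ⊗ ψ → ∀ s → X s → P s ⊎ Q s
⊗-elim φ ψ f g (Y , Z , _ , _ , (X⊆Y∪Z , _) , p , q) s s∈ with X⊆Y∪Z s∈
... | inj₁ s∈Y = inj₁ (f Y p s s∈Y)
... | inj₂ s∈Z = inj₂ (g Z q s s∈Z)

-- The empty team property, by which a team falsifying a formula must be nonempty.
⊨-empty : ∀ φ X → Empty X → X ⊨ φ
⊨-empty (var i)    X ∅ = lift λ s s∈ → contradiction s∈ (∅ s)
⊨-empty (¬var i)   X ∅ = lift λ s s∈ → contradiction s∈ (∅ s)
⊨-empty bot        X ∅ = lift ∅
⊨-empty (dep is j) X ∅ = lift λ s _ s∈ → contradiction s∈ (∅ s)
⊨-empty (φ ∧ ψ)    X ∅ = ⊨-empty φ X ∅ , ⊨-empty ψ X ∅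
⊨-empty (φ ⊗ ψ)    X ∅ = ⊗-intro φ ψ {P = X} {Q = X} (λ _ → inj₁)
  (⊨-empty φ _ λ s → ∅ s ∘ proj₁) (⊨-empty ψ _ λ s → ∅ s ∘ proj₁)

-- Locality and downward closure in one statement.
⊨-local : ∀ (is : Vec ℕ n) φ → All (_∈ is) (vars φ) → ∀ X X′ →
          (∀ s → X′ s → ∃[ t ] X t × s ↾ is ≡ t ↾ is) → X ⊨ φ → X′ ⊨ φ
⊨-local is (var i) (i∈ ∷ []) X X′ sub (lift p) = lift λ s s∈ →
  let t , t∈ , eq = sub s s∈ in trans (↾-agree i∈ eq) (p t t∈)
⊨-local is (¬var i) (i∈ ∷ []) X X′ sub (lift p) = lift λ s s∈ →
  let t , t∈ , eq = sub s s∈ in trans (↾-agree i∈ eq) (p t t∈)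
⊨-local is bot _ X X′ sub (lift p) = lift λ s s∈ →
  let t , t∈ , _ = sub s s∈ in p t t∈
⊨-local is (dep js j) js∈ X X′ sub (lift p) = lift λ s s′ s∈ s′∈ agree →
  let t  , t∈  , eq  = sub s s∈
      t′ , t′∈ , eq′ = sub s′ s′∈
      j∈             = All.head (++⁻ʳ js js∈)
      agree′         = All.zipWith
        (λ (i∈ , si≡s′i) → trans (sym (↾-agree i∈ eq)) (trans si≡s′i (↾-agree i∈ eq′)))
        (++⁻ˡ js js∈ , agree)
  in trans (↾-agree j∈ eq) (trans (p t t′ t∈ t′∈ agree′) (sym (↾-agree j∈ eq′)))
⊨-local is (φ ∧ ψ) vars∈ X X′ sub (p , q) =
  ⊨-local is φ (++⁻ˡ (vars φ) vars∈) X X′ sub p ,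
  ⊨-local is ψ (++⁻ʳ (vars φ) vars∈) X X′ sub q
⊨-local is (φ ⊗ ψ) vars∈ X X′ sub (Y , Z , _ , _ , (X⊆Y∪Z , _) , p , q) =
  -- The split of `X` is carried over to `X′`: a valuation goes to the side where some valuation
  -- agrees with it on `is`, possibly to both.
  ⊗-intro φ ψ {P = saturation Y} {Q = saturation Z} cover
    (⊨-local is φ (++⁻ˡ (vars φ) vars∈) Y _ (λ _ → proj₂) p)
    (⊨-local is ψ (++⁻ʳ (vars φ) vars∈) Z _ (λ _ → proj₂) q)
  where
  saturation : Team → Team
  saturation W s = ∃[ t ] W t × s ↾ is ≡ t ↾ is
  cover : ∀ s → X′ s → saturation Y s ⊎ saturation Z s
  cover s s∈ with sub s s∈
  ... | t , t∈ , eq with X⊆Y∪Z t∈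
  ...   | inj₁ t∈Y = inj₁ (t , t∈Y , eq)
  ...   | inj₂ t∈Z = inj₂ (t , t∈Z , eq)

-- Meaning of conjunctions, literals, Θ and α

⊨-⋀⇔ : ∀ i φs X → (X ⊨ ⋀ i φs) ⇔ All (X ⊨_) φs
⊨-⋀⇔ i []           X = mk⇔ (λ _ → []) (λ _ → ⊨-top i X)
⊨-⋀⇔ i (φ ∷ [])     X = mk⇔ (_∷ []) All.head
⊨-⋀⇔ i (φ ∷ ψ ∷ φs) X = mk⇔
  (λ (p , q) → p ∷ to (⊨-⋀⇔ i (ψ ∷ φs) X) q)
  (λ ps → All.head ps , from (⊨-⋀⇔ i (ψ ∷ φs) X) (All.tail ps))

⊨-literal⇔ : ∀ i b X → (X ⊨ literal i b) ⇔ (∀ s → X s → s i ≡ b)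
⊨-literal⇔ i true  X = mk⇔ lower lift
⊨-literal⇔ i false X = mk⇔ lower lift

conj : Vec ℕ (suc n) → Vec Bool (suc n) → Formula
conj is v = ⋀⁺ (Vec.zipWith literal is v)

⊨-conj⇔ : ∀ (is : Vec ℕ (suc n)) v X → (X ⊨ conj is v) ⇔ (∀ s → X s → s ↾ is ≡ v)
⊨-conj⇔ (i ∷ []) (b ∷ []) X = mk⇔
  (λ p s s∈ → cong (_∷ []) (to (⊨-literal⇔ i b X) p s s∈))
  (λ p → from (⊨-literal⇔ i b X) λ s s∈ → ∷-injectiveˡ (p s s∈))
⊨-conj⇔ (i ∷ is@(_ ∷ _)) (b ∷ v@(_ ∷ _)) X = mk⇔
  (λ (p , q) s s∈ → cong₂ _∷_ (to (⊨-literal⇔ i b X) p s s∈) (to (⊨-conj⇔ is v X) q s s∈))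
  (λ p → from (⊨-literal⇔ i b X) (λ s s∈ → ∷-injectiveˡ (p s s∈))
       , from (⊨-conj⇔ is v X) (λ s s∈ → ∷-injectiveʳ (p s s∈)))

-- This is α₁.
constant : Vec ℕ (suc n) → Formula
constant is = ⋀⁺ (Vec.map (dep []) is)

⊨-constant⇔ : ∀ (is : Vec ℕ (suc n)) X →
              (X ⊨ constant is) ⇔ (∀ s s′ → X s → X s′ → s ↾ is ≡ s′ ↾ is)
⊨-constant⇔ (i ∷ []) X = mk⇔
  (λ (lift p) s s′ s∈ s′∈ → cong (_∷ []) (p s s′ s∈ s′∈ []))
  (λ p → lift λ s s′ s∈ s′∈ _ → ∷-injectiveˡ (p s s′ s∈ s′∈))
⊨-constant⇔ (i ∷ is@(_ ∷ _)) X = mk⇔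
  (λ (lift p , q) s s′ s∈ s′∈ →
    cong₂ _∷_ (p s s′ s∈ s′∈ []) (to (⊨-constant⇔ is X) q s s′ s∈ s′∈))
  (λ p → lift (λ s s′ s∈ s′∈ _ → ∷-injectiveˡ (p s s′ s∈ s′∈))
       , from (⊨-constant⇔ is X) λ s s′ s∈ s′∈ → ∷-injectiveʳ (p s s′ s∈ s′∈))

-- Stated for an arbitrary list `vs`, so that it serves both for `Θ` and, after weakening the
-- disjuncts, for `α`.
⊨-⨂conj⇔ : ∀ (is : Vec ℕ (suc n)) vs X →
           (X ⊨ ⨂ (List.map (conj is) vs)) ⇔ (∀ s → X s → s ↾ is ∈ₗ vs)
⊨-⨂conj⇔ is [] X = mk⇔
  (λ (lift ∅) s s∈ → contradiction s∈ (∅ s))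
  (λ p → lift λ s s∈ → contradiction (p s s∈) λ ())
⊨-⨂conj⇔ is (v ∷ []) X = mk⇔
  (λ p s s∈ → here (to (⊨-conj⇔ is v X) p s s∈))
  (λ p → from (⊨-conj⇔ is v X) λ s s∈ → singleton⁻ (p s s∈))
⊨-⨂conj⇔ is (v ∷ vs@(_ ∷ _)) X = mk⇔
  (λ p s s∈ → Any.fromSum
    (⊗-elim (conj is v) (⨂ (List.map (conj is) vs))
      (λ Y → to (⊨-conj⇔ is v Y)) (λ Z → to (⊨-⨂conj⇔ is vs Z)) p s s∈))
  (λ p → ⊗-intro (conj is v) (⨂ (List.map (conj is) vs))
    (λ s s∈ → Any.toSum (p s s∈))
    (from (⊨-conj⇔ is v _) λ _ → proj₂) (from (⊨-⨂conj⇔ is vs _) λ _ → proj₂))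

⊨-Θ⇔ : ∀ (is : Vec ℕ (suc n)) Y X → (X ⊨ Θ is Y) ⇔ (∀ s → X s → Y (s ↾ is) ≡ true)
⊨-Θ⇔ is Y X = mk⇔
  (λ p s s∈ → ∈-elements⁻ Y (to (⊨-⨂conj⇔ is (elements Y) X) p s s∈))
  (λ p → from (⊨-⨂conj⇔ is (elements Y) X) λ s s∈ → ∈-elements⁺ Y (p s s∈))

⊨-⨂-mono : ∀ {φs ψs} → Pointwise (λ φ ψ → ∀ X → X ⊨ φ → X ⊨ ψ) φs ψs →
           ∀ X → X ⊨ ⨂ φs → X ⊨ ⨂ ψs
⊨-⨂-mono []                X p = p
⊨-⨂-mono (f ∷ [])          X p = f X p
⊨-⨂-mono (f ∷ fs@(_ ∷ _)) X (Y , Z , Y⊆X , Z⊆X , X≐ , p , q) =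
  Y , Z , Y⊆X , Z⊆X , X≐ , f Y p , ⊨-⨂-mono fs Z q

-- Fixing the values of all variables makes them constant, so each `conj is v` can be weakened to
-- `constant is` without changing the split.
⊨-α⁺ : ∀ (is : Vec ℕ (suc n)) vs X → (∀ s → X s → s ↾ is ∈ₗ vs) → X ⊨ α is (length vs)
⊨-α⁺ is vs X p = ⊨-⨂-mono (pointwise vs) X (from (⊨-⨂conj⇔ is vs X) p)
  where
  pointwise : ∀ vs → Pointwise (λ φ ψ → ∀ X → X ⊨ φ → X ⊨ ψ)
                       (List.map (conj is) vs) (List.replicate (length vs) (constant is))
  pointwise []       = []
  pointwise (v ∷ vs) = (λ X p → from (⊨-constant⇔ is X) λ s s′ s∈ s′∈ →
    trans (to (⊨-conj⇔ is v X) p s s∈) (sym (to (⊨-conj⇔ is v X) p s′ s′∈))) ∷ pointwise vs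

-- Clauses and the normal form, classically

module _ (em : ExcludedMiddle (lsuc 0ℓ)) where

  em₀ : ExcludedMiddle 0ℓ
  em₀ = map′ lower lift em

  -- Each of the `k` parts is constant on `is`, so it contributes a single entry to `vs`.
  ⊨-α⁻ : ∀ (is : Vec ℕ (suc n)) k X → X ⊨ α is k →
         ∃[ vs ] length vs ≡ k × (∀ s → X s → s ↾ is ∈ₗ vs)
  ⊨-α⁻ is zero X (lift ∅) = [] , refl , λ s s∈ → contradiction s∈ (∅ s)
  ⊨-α⁻ is (suc zero) X p with em₀ {∃ X}
  ... | yes (t , t∈) = t ↾ is ∷ [] , refl , λ s s∈ → here (to (⊨-constant⇔ is X) p s t s∈ t∈)
  -- An empty part attains no value; an arbitrary vector keeps the length exactly 1.
  ... | no ∅         = Vec.replicate _ true ∷ [] , refl , λ s s∈ → contradiction (s , s∈) ∅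
  ⊨-α⁻ is (suc (suc k)) X (Y , Z , _ , _ , (X⊆Y∪Z , _) , p , q)
    with vs , len-vs , p′ ← ⊨-α⁻ is 1 Y p
       | ws , len-ws , q′ ← ⊨-α⁻ is (suc k) Z q
    = vs ++ ws , trans (length-++ vs) (cong₂ _+_ len-vs len-ws) , cover
    where
    cover : ∀ s → X s → s ↾ is ∈ₗ vs ++ ws
    cover s s∈ with X⊆Y∪Z s∈
    ... | inj₁ s∈Y = ∈-++⁺ˡ (p′ s s∈Y)
    ... | inj₂ s∈Z = ∈-++⁺ʳ vs (q′ s s∈Z)

  -- If `X` attained all of `Y`, the part satisfying Θ would attain none of it, leaving `k + 1`
  -- values to a part that has at most `k`. Conversely, if some `v` in `Y` is missed, the valuations
  -- of `X` restricting into `Y` attain at most `k` values, and the others satisfy Θ.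
  ⊨-clause⇔ : ∀ (is : Vec ℕ (suc n)) Y k → ∣ Y ∣ ≡ suc k → ∀ X →
              (X ⊨ α is k ⊗ Θ is (∁ Y)) ⇔ (¬ Y ⊆ X ↾ is)
  ⊨-clause⇔ is Y k ∣Y∣≡1+k X = mk⇔ ⇒ ⇐
    where
    ⇒ : X ⊨ α is k ⊗ Θ is (∁ Y) → ¬ Y ⊆ X ↾ is
    ⇒ (V , W , _ , _ , (X⊆V∪W , _) , p , q) Y⊆X with ⊨-α⁻ is k V p
    ... | vs , refl , V⊆vs = 1+n≰n (subst (_≤ length vs) ∣Y∣≡1+k
                               (Unique-⊆⇒length≤ (elements-unique Y) ∈vs))
      where
      ∈vs : ∀ {v} → v ∈ₗ elements Y → v ∈ₗ vs
      ∈vs {v} v∈ with Y⊆X v (∈-elements⁻ Y v∈)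
      ... | s , s∈X , refl with X⊆V∪W s∈X
      ...   | inj₁ s∈V = V⊆vs s s∈V
      ...   | inj₂ s∈W = contradiction
        (trans (sym (cong not (∈-elements⁻ Y v∈))) (to (⊨-Θ⇔ is (∁ Y) W) q s s∈W)) λ ()

    ⇐ : ¬ Y ⊆ X ↾ is → X ⊨ α is k ⊗ Θ is (∁ Y)
    ⇐ Y⊈X with em₀ {∃[ v ] Y v ≡ true × ¬ (∃[ s ] X s × s ↾ is ≡ v)}
    ... | no none = contradiction
      (λ v Yv → decidable-stable em₀ λ v∉X → none (v , Yv , v∉X)) Y⊈X
    -- Splitting `elements Y` at the missed `v` leaves `as ++ bs`, which has exactly `k` entries.
    ... | yes (v , Yv , v∉X) with elements Y in eq | ∈-∃++ (∈-elements⁺ Y Yv)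
    ...   | _ | as , bs , refl =
      ⊗-intro (α is k) (Θ is (∁ Y)) {P = λ s → Y (s ↾ is) ≡ true} (λ s _ → ∈-or-∈∁ Y (s ↾ is))
        (subst (λ k → V ⊨ α is k) len (⊨-α⁺ is (as ++ bs) V V⊆))
        (from (⊨-Θ⇔ is (∁ Y) _) λ _ → proj₂)
      where
      V : Team
      V s = X s × Y (s ↾ is) ≡ true
      len : length (as ++ bs) ≡ k
      len = suc-injective (trans (sym (length-insert as)) ∣Y∣≡1+k)
      V⊆ : ∀ s → V s → s ↾ is ∈ₗ as ++ bs
      V⊆ s (s∈X , Ys) = ∈-remove as (subst (s ↾ is ∈ₗ_) eq (∈-elements⁺ Y Ys))
        λ s≡v → v∉X (s , s∈X , s≡v)

mainTheorem3 : ExcludedMiddle (lsuc 0ℓ) →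
    ∀ (n : ℕ) (is : Vec ℕ (suc n)) → Unique is →
    ∀ (φ : Formula) → All (_∈ is) (vars φ) →
    ∃[ m ] Σ[ k ∈ (Fin m → ℕ) ] Σ[ Y ∈ (Fin m → TeamOn (suc n)) ]
    ((∀ g → Nonempty (Y g) × ∣ Y g ∣ ≡ suc (k g)) ×
    φ ≡ₛ ⋀ (head is) (tabulate (λ g → α is (k g) ⊗ Θ is (∁ (Y g)))))
mainTheorem3 em n is _ φ vars∈ =
  length G , k , List.lookup G , (λ g → nonempty g , size g) , λ X → mk⇔ (⇒ X) (⇐ X)
  where
  falsifies? : (Y : TeamOn (suc n)) → Dec (¬ (extend is Y ⊨ φ))
  falsifies? _ = em

  G : List (TeamOn (suc n))
  G = List.filter falsifies? (teamsOn (suc n))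

  -- The truncation in `pred` is harmless: the teams in `G` are nonempty, so `size` recovers the
  -- exact cardinality.
  k : Fin (length G) → ℕ
  k g = pred ∣ List.lookup G g ∣

  falsifies : ∀ g → ¬ (extend is (List.lookup G g) ⊨ φ)
  falsifies g = proj₂ (∈-filter⁻ falsifies? {xs = teamsOn (suc n)} (∈-lookup {xs = G} g))

  nonempty : ∀ g → Nonempty (List.lookup G g)
  nonempty g = decidable-stable (em₀ em) λ ∅ →
    falsifies g (⊨-empty φ _ λ s s∈ → ∅ (s ↾ is , s∈))

  size : ∀ g → ∣ List.lookup G g ∣ ≡ suc (k g)
  size g = ∣∣-nonempty (List.lookup G g) (nonempty g)

  clause⇔ : ∀ g X → _ ⇔ _
  clause⇔ g = ⊨-clause⇔ em is (List.lookup G g) (k g) (size g)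

  clauses : List Formula
  clauses = tabulate λ g → α is (k g) ⊗ Θ is (∁ (List.lookup G g))

  ⇒ : ∀ X → X ⊨ φ → X ⊨ ⋀ (head is) clauses
  -- If `X` attained all of a falsifying team, `⊨-local` would transfer `φ` from `X` to the
  -- extension of that team.
  ⇒ X X⊨φ = from (⊨-⋀⇔ _ clauses X) (All.tabulate⁺ λ g → from (clause⇔ g X) λ Y⊆X →
    falsifies g (⊨-local is φ vars∈ X _
      (λ s s∈ → let t , t∈ , eq = Y⊆X (s ↾ is) s∈ in t , t∈ , sym eq) X⊨φ))

  ⇐ : ∀ X → X ⊨ ⋀ (head is) clauses → X ⊨ φ
  -- Excluded middle turns the restriction of `X` to `is` into a Boolean team; `Y` is its copy in
  -- the list `teamsOn (suc n)`.
  ⇐ X X⊨cnf with Y , Y∈ , Y≗ ← teamsOn-complete (λ v → does (em₀ em {∃[ s ] X s × s ↾ is ≡ v}))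
    = decidable-stable em λ X⊭φ →
      -- `X` lies inside `extend is Y`, so if `X` falsifies `φ` then so does the extension, and `Y`
      -- indexes a clause. That clause denies that `X` attains all of `Y`, contrary to the choice of
      -- `Y`.
      let Y∈G = ∈-filter⁺ falsifies? Y∈ λ Y⊨φ → X⊭φ (⊨-local is φ vars∈ _ X
                  (λ s s∈ → s , trans (Y≗ _) (dec-true (em₀ em) (s , s∈ , refl)) , refl) Y⊨φ)
          g   = Any.index Y∈G
      in to (clause⇔ g X) (All.tabulate⁻ (to (⊨-⋀⇔ _ clauses X) X⊨cnf) g)
           (subst (_⊆ X ↾ is) (lookup-index Y∈G) λ v Yv →
             witness (em₀ em) (trans (sym (Y≗ v)) Yv))
    where
    witness : ∀ {P : Set} (P? : Dec P) → does P? ≡ true → P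
    witness (yes p) _ = p
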